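{- For every integer $n \ge 1$, \[f(n,1) + f(n+1,2) + \cdots = \sum_{d \ge 1} f(n+d-1,d) = p(n-1),\] where the sum has only finitely many nonzero terms.
   Context: A partition of a positive integer $n$ is a finite sequence of positive integers $\lambda = (\lambda_1,\ldots,\lambda_j)$ with $\lambda_1 \ge \cdots \ge \lambda_j$ and $\sum_i \lambda_i = n$; the $\lambda_i$ are its parts. For integers $n \ge 1$ and $d \ge 1$, a partition $\lambda$ of $n$ has fixed point $d$ if $\lambda$ has at least $d$ parts and $\lambda_d = d$. Let $f(n,d)$ denote the number of partitions of $n$ with fixed point $d$. Let $p(n)$ denote the number of partitions of $n$, with the convention $p(0)=1$. -}

module Defs where

open import Data.Fin using (toℕ)
open import Data.Fin.Properties using (any?)
open import Data.List
  using (List; []; _∷_; length; lookup; filter; upTo; applyUpTo; concatMap; cartesianProductWith)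
open import Data.List.Membership.Propositional using (_∈_; lose)
open import Data.List.Membership.Propositional.Properties
  using (∈-filter⁺; ∈-filter⁻; ∈-upTo⁺; ∈-concatMap⁺; ∈-cartesianProductWith⁺; ∈-cartesianProductWith⁻)
open import Data.List.Properties using (∷-injective)
open import Data.List.Relation.Binary.Disjoint.Propositional using (Disjoint)
open import Data.List.Relation.Unary.All using (All; []; _∷_; all?)
import Data.List.Relation.Unary.All as All
open import Data.List.Relation.Unary.AllPairs using ([]; _∷_)
import Data.List.Relation.Unary.AllPairs as AllPairs
import Data.List.Relation.Unary.AllPairs.Properties as AllPairs
import Data.List.Relation.Unary.All.Properties as All
open import Data.List.Relation.Unary.Any using (here)
open import Data.List.Relation.Unary.Linked using (Linked; linked?)
open import Data.List.Relation.Unary.Unique.Propositional using (Unique)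
import Data.List.Relation.Unary.Unique.Propositional.Properties as Unique
open import Data.Nat
open import Data.Nat.ListAction using (sum)
open import Data.Nat.Properties
open import Data.Product using (∃-syntax; _×_; _,_; proj₂)
open import Function using (_⇔_; mk⇔)
open import Relation.Binary.PropositionalEquality
open import Relation.Nullary using (Dec)
open import Relation.Nullary.Decidable using (map′; _×-dec_)

record IsPartition (n : ℕ) (parts : List ℕ) : Set where
  constructor isPartition
  field
    positive   : All (1 ≤_) parts
    decreasing : Linked _≥_ parts
    total      : sum parts ≡ n

isPartition? : ∀ n parts → Dec (IsPartition n parts)
isPartition? n parts =
  map′ (λ (a , b , c) → isPartition a b c) (λ (isPartition a b c) → a , b , c)
       (all? (1 ≤?_) parts ×-dec linked? _≥?_ parts ×-dec (sum parts ≟ n))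

-- Parts are indexed from 1, so λ_d is the entry at the 0-based position i
-- with suc (toℕ i) ≡ d.  The existence of i says that there are at least d parts.
HasFixedPoint : ℕ → List ℕ → Set
HasFixedPoint d parts =
  ∃[ i ] suc (toℕ i) ≡ d × lookup parts i ≡ d

hasFixedPoint? : ∀ d parts → Dec (HasFixedPoint d parts)
hasFixedPoint? d parts =
  any? (λ i → (suc (toℕ i) ≟ d) ×-dec (lookup parts i ≟ d))

words : List ℕ → ℕ → List (List ℕ)
words as zero    = [] ∷ []
words as (suc k) = cartesianProductWith _∷_ as (words as k)

-- A partition of n has at most n parts, each at most n, so filtering the
-- words of length ≤ n in the letters 0, …, n finds each one exactly once:
-- see ∈-partitions and partitions-unique.
partitions : ℕ → List (List ℕ)
partitions n = filter (isPartition? n) (concatMap (words (upTo (suc n))) (upTo (suc n)))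

p : ℕ → ℕ
p n = length (partitions n)

f : ℕ → ℕ → ℕ
f n d = length (filter (hasFixedPoint? d) (partitions n))

-- ∑_{d ≥ 1} g d has only finitely many nonzero terms, and its value is s.
SumFrom1 : (ℕ → ℕ) → ℕ → Set
SumFrom1 g s =
  ∃[ N ] (∀ d → N < d → g d ≡ 0) × sum (applyUpTo (λ i → g (suc i)) N) ≡ s

p[0]≡1 : p 0 ≡ 1
p[0]≡1 = refl

private
  length≤sum : ∀ {xs} → All (1 ≤_) xs → length xs ≤ sum xs
  length≤sum []       = z≤n
  length≤sum (q ∷ qs) = +-mono-≤ q (length≤sum qs)

  parts≤sum : ∀ xs → All (_≤ sum xs) xs
  parts≤sum []       = []
  parts≤sum (x ∷ xs) =
    m≤m+n x (sum xs) ∷ All.map (λ q → ≤-trans q (m≤n+m (sum xs) x)) (parts≤sum xs)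

  ∈-words : ∀ {as} xs → All (_∈ as) xs → xs ∈ words as (length xs)
  ∈-words []       []       = here refl
  ∈-words (x ∷ xs) (q ∷ qs) = ∈-cartesianProductWith⁺ _∷_ q (∈-words xs qs)

  length-words : ∀ as k {xs} → xs ∈ words as k → length xs ≡ k
  length-words as zero    (here refl) = refl
  length-words as (suc k) q with ∈-cartesianProductWith⁻ _∷_ as (words as k) q
  ... | _ , _ , _ , r , refl = cong suc (length-words as k r)

  words-unique : ∀ {as} → Unique as → ∀ k → Unique (words as k)
  words-unique u zero    = [] ∷ []
  words-unique u (suc k) = Unique.cartesianProductWith⁺ _∷_ ∷-injective u (words-unique u k)

  words-disjoint : ∀ as {j k} → j ≢ k → Disjoint (words as j) (words as k)
  words-disjoint as j≢k (q , r) =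
    j≢k (trans (sym (length-words as _ q)) (length-words as _ r))

∈-partitions : ∀ n parts → parts ∈ partitions n ⇔ IsPartition n parts
∈-partitions n parts = mk⇔ (λ q → proj₂ (∈-filter⁻ (isPartition? n) {xs = candidates} q)) complete
  where
  candidates = concatMap (words (upTo (suc n))) (upTo (suc n))

  complete : IsPartition n parts → parts ∈ partitions n
  complete q@(isPartition pos _ refl) = ∈-filter⁺ (isPartition? n)
    (∈-concatMap⁺ (words (upTo (suc n)))
      (lose (∈-upTo⁺ (s≤s (length≤sum pos)))
        (∈-words parts (All.map (λ r → ∈-upTo⁺ (s≤s r)) (parts≤sum parts)))))
    q

partitions-unique : ∀ n → Unique (partitions n)
partitions-unique n = Unique.filter⁺ (isPartition? n)
  (Unique.concat⁺
    (All.map⁺ (All.universal (words-unique letters) (upTo (suc n))))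
    (AllPairs.map⁺ (AllPairs.map (words-disjoint (upTo (suc n))) letters)))
  where
  letters : Unique (upTo (suc n))
  letters = Unique.upTo⁺ (suc n)

{-# OPTIONS --safe #-}

-- Removing the part λ_d = d from a partition λ of n + d − 1 leaves a partition
-- μ of n − 1 with μ_{d−1} ≥ d ≥ μ_d (with μ_0 = ∞, and μ_d = 0 if absent).
-- Conversely, since μ decreases, these inequalities hold for exactly one d,
-- namely the least d with μ_d ≤ d.  So every partition of n − 1 arises exactly
-- once as d varies.

module Submission where

open import Defs
open import Data.Nat using (ℕ; _+_; _∸_; _≤_)

open import Data.Fin using (zero; suc; toℕ)
open import Data.List using (List; []; _∷_; length; lookup; map; filter; applyUpTo; concat; removeAt)
open import Data.List.Membership.Propositional using (_∈_)
open import Data.List.Membership.Propositional.Properties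
  using (∈-filter⁺; ∈-filter⁻; ∈-applyUpTo⁺; ∈-applyUpTo⁻; ∈-concat⁺′; ∈-concat⁻′; ∈-map⁺; ∈-map⁻)
open import Data.List.Membership.Propositional.Properties.WithK using (unique∧set⇒bag)
open import Data.List.Properties using (length-++; length-map; map-applyUpTo; filter-none; ∷-injectiveˡ; ∷-injectiveʳ)
open import Data.List.Relation.Binary.BagAndSetEquality using (∼bag⇒↭)
open import Data.List.Relation.Binary.Disjoint.Propositional using (Disjoint)
open import Data.List.Relation.Binary.Permutation.Propositional using (_↭_; refl; prep; swap; trans; ↭-sym)
open import Data.List.Relation.Binary.Permutation.Propositional.Properties using (All-resp-↭; ↭-length)
open import Data.List.Relation.Unary.All as All using (All; []; _∷_)
import Data.List.Relation.Unary.All.Properties as All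
import Data.List.Relation.Unary.AllPairs.Properties as AllPairs
open import Data.List.Relation.Unary.Linked as Linked using (Linked; []; [-]; _∷_)
open import Data.List.Relation.Unary.Unique.Propositional using (Unique)
import Data.List.Relation.Unary.Unique.Propositional.Properties as Unique
open import Data.Maybe.Relation.Binary.Connected using (just)
open import Data.Nat using (zero; suc; _<_; _≥_; _≤?_; s≤s)
open import Data.Nat.ListAction using (sum)
open import Data.Nat.ListAction.Properties using (sum-↭)
open import Data.Nat.Properties
open import Data.Product using (∃-syntax; _×_; _,_; proj₁; proj₂)
open import Function using (_∘_; _⇔_; mk⇔; Equivalence)
open import Function.Definitions using (Injective)
open import Relation.Binary.PropositionalEquality
  using (_≡_; _≢_; refl; sym; cong; cong₂; subst; module ≡-Reasoning)
  renaming (trans to ≡-trans)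
open import Relation.Nullary using (yes; no; contradiction)

length-concat : ∀ {a} {A : Set a} (xss : List (List A)) → length (concat xss) ≡ sum (map length xss)
length-concat []         = refl
length-concat (xs ∷ xss) = ≡-trans (length-++ xs) (cong (length xs +_) (length-concat xss))

-- In a duplicate-free list membership has at most one proof, so agreeing as sets already means
-- agreeing as bags, which yields a permutation.
unique-length : ∀ {a} {A : Set a} {xs ys : List A} → Unique xs → Unique ys →
                (∀ {v} → v ∈ xs ⇔ v ∈ ys) → length xs ≡ length ys
unique-length u v same = ↭-length (∼bag⇒↭ (unique∧set⇒bag u v same))

-- In both functions k is the index, counted from 1, of the head of the list in
-- the partition of which the list is a tail.
fixedPart : ℕ → List ℕ → ℕ
fixedPart k [] = k
fixedPart k (x ∷ xs) with x ≤? k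
... | yes _ = k
... | no  _ = fixedPart (suc k) xs

insertFixed : ℕ → List ℕ → List ℕ
insertFixed k [] = k ∷ []
insertFixed k (x ∷ xs) with x ≤? k
... | yes _ = k ∷ x ∷ xs
... | no  _ = x ∷ insertFixed (suc k) xs

-- Transports positivity and the sum of the parts through insertion and deletion; only monotonicity
-- depends on where the part goes.
insertFixed-↭ : ∀ k xs → insertFixed k xs ↭ fixedPart k xs ∷ xs
insertFixed-↭ k [] = refl
insertFixed-↭ k (x ∷ xs) with x ≤? k
... | yes _ = refl
... | no  _ = trans (prep x (insertFixed-↭ (suc k) xs)) (swap x _ refl)

-- Equal outputs force both scans to take the same branch: a scan that stops puts `k` in front,
-- while one that goes on keeps a head larger than `k`.
insertFixed-injective : ∀ k → Injective _≡_ _≡_ (insertFixed k)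
insertFixed-injective k {[]}     {[]}     eq = refl
insertFixed-injective k {[]}     {y ∷ ys} eq with y ≤? k
... | no y≰k = contradiction (≤-reflexive (sym (∷-injectiveˡ eq))) y≰k
insertFixed-injective k {x ∷ xs} {[]}     eq with x ≤? k
... | no x≰k = contradiction (≤-reflexive (∷-injectiveˡ eq)) x≰k
insertFixed-injective k {x ∷ xs} {y ∷ ys} eq with x ≤? k | y ≤? k
... | yes _  | yes _  = ∷-injectiveʳ eq
... | yes _  | no y≰k = contradiction (≤-reflexive (sym (∷-injectiveˡ eq))) y≰k
... | no x≰k | yes _  = contradiction (≤-reflexive (∷-injectiveˡ eq)) x≰k
... | no _   | no _   =
  cong₂ _∷_ (∷-injectiveˡ eq) (insertFixed-injective (suc k) (∷-injectiveʳ eq))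

k≤fixedPart : ∀ k xs → k ≤ fixedPart k xs
k≤fixedPart k [] = ≤-refl
k≤fixedPart k (x ∷ xs) with x ≤? k
... | yes _ = ≤-refl
... | no  _ = ≤-trans (n≤1+n k) (k≤fixedPart (suc k) xs)

-- Each head passed exceeds `k`, so it is at least 1 and pays for the index rising by one.
fixedPart≤ : ∀ k xs → fixedPart k xs ≤ k + sum xs
fixedPart≤ k [] = m≤m+n k 0
fixedPart≤ k (x ∷ xs) with x ≤? k
... | yes _  = m≤m+n k _
... | no x≰k = begin
  fixedPart (suc k) xs ≤⟨ fixedPart≤ (suc k) xs ⟩
  suc k + sum xs       ≡⟨ +-suc k (sum xs) ⟨
  k + (1 + sum xs)     ≤⟨ +-monoʳ-≤ k (+-monoˡ-≤ (sum xs) (m<n⇒0<n (≰⇒> x≰k))) ⟩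
  k + (x + sum xs)     ∎
  where open ≤-Reasoning

-- The last head passed, `x`, is carried along because the inserted part lands right after it if the
-- scan stops. A failed test at one position is exactly the bound `k ≤ x` required at the next.
∷-insertFixed-decreasing⁺ : ∀ k {x xs} → k ≤ x → Linked _≥_ (x ∷ xs) → Linked _≥_ (x ∷ insertFixed k xs)
∷-insertFixed-decreasing⁺ k {xs = []} k≤x l = k≤x ∷ [-]
∷-insertFixed-decreasing⁺ k {xs = y ∷ ys} k≤x (x≥y ∷ l) with y ≤? k
... | yes y≤k = k≤x ∷ y≤k ∷ l
... | no  y≰k = x≥y ∷ ∷-insertFixed-decreasing⁺ (suc k) (≰⇒> y≰k) l

insertFixed-decreasing⁺ : ∀ k {xs} → Linked _≥_ xs → Linked _≥_ (insertFixed k xs)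
insertFixed-decreasing⁺ k {[]} l = [-]
insertFixed-decreasing⁺ k {x ∷ xs} l with x ≤? k
... | yes x≤k = x≤k ∷ l
... | no  x≰k = ∷-insertFixed-decreasing⁺ (suc k) (≰⇒> x≰k) l

removeAt-decreasing : ∀ {xs} i → Linked _≥_ xs → Linked _≥_ (removeAt xs i)
removeAt-decreasing zero [-] = []
removeAt-decreasing zero (_ ∷ l) = l
removeAt-decreasing (suc zero) (_ ∷ [-]) = [-]
removeAt-decreasing (suc zero) (x≥y ∷ y≥z ∷ l) = ≤-trans y≥z x≥y ∷ l
removeAt-decreasing (suc (suc i)) (x≥y ∷ l) = x≥y ∷ removeAt-decreasing (suc i) l

-- The position `i` is 0-based in the tail, so `k + toℕ i` is its 1-based index in the whole
-- partition; for `k` equal to 1 this is a fixed point.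
insertFixed-fixed : ∀ k xs → ∃[ i ] k + toℕ i ≡ fixedPart k xs × lookup (insertFixed k xs) i ≡ fixedPart k xs
insertFixed-fixed k [] = zero , +-identityʳ k , refl
insertFixed-fixed k (x ∷ xs) with x ≤? k
... | yes _ = zero , +-identityʳ k , refl
... | no  _ with i , index , value ← insertFixed-fixed (suc k) xs =
  suc i , ≡-trans (+-suc k (toℕ i)) index , value

lookup≤head : ∀ {x xs} → Linked _≥_ (x ∷ xs) → ∀ i → lookup (x ∷ xs) i ≤ x
lookup≤head l = Linked.lookup (λ q r → ≤-trans r q) l (just ≤-refl)

-- The scan finds the deleted place again. Entries before it are at least the fixed part, hence
-- above their own index, so the scan passes them; the entry after it, if any, is at most the fixed
-- part, so the scan stops.
insertFixed-removeAt : ∀ k ys i → Linked _≥_ ys → lookup ys i ≡ k + toℕ i →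
                       insertFixed k (removeAt ys i) ≡ ys × fixedPart k (removeAt ys i) ≡ k + toℕ i
insertFixed-removeAt k (y ∷ []) zero l eq with refl ← ≡-trans eq (+-identityʳ k) =
  refl , sym (+-identityʳ k)
insertFixed-removeAt k (y ∷ z ∷ ys) zero (y≥z ∷ l) eq with refl ← ≡-trans eq (+-identityʳ k) with z ≤? k
... | yes _  = refl , sym (+-identityʳ k)
... | no z≰k = contradiction y≥z z≰k
insertFixed-removeAt k (y ∷ ys@(_ ∷ _)) (suc i) l@(_ ∷ l′) eq with y ≤? k
-- Stopping early would give `k + suc (toℕ i) ≤ y ≤ k`.
... | yes y≤k = contradiction
  (≤-trans (≤-reflexive (sym eq)) (≤-trans (lookup≤head l (suc i)) y≤k)) (m+1+n≰m k)
... | no _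
  with inserted , part ← insertFixed-removeAt (suc k) ys i l′ (≡-trans eq (+-suc k (toℕ i))) =
  cong (y ∷_) inserted , ≡-trans part (sym (+-suc k (toℕ i)))

insertFixed-isPartition : ∀ {m xs} → IsPartition m xs →
                          IsPartition (m + fixedPart 1 xs) (insertFixed 1 xs)
insertFixed-isPartition {xs = xs} (isPartition pos dec refl) = isPartition
  (All-resp-↭ (↭-sym (insertFixed-↭ 1 xs)) (k≤fixedPart 1 xs ∷ pos))
  (insertFixed-decreasing⁺ 1 dec)
  (≡-trans (sum-↭ (insertFixed-↭ 1 xs)) (+-comm (fixedPart 1 xs) (sum xs)))

-- The preimage is `ys` with its fixed part deleted. The last component records that insertion
-- restores the same `d`, which later bounds `d`.
insertFixed-surjective : ∀ {m d ys} → IsPartition (m + d) ys → HasFixedPoint d ys →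
                         ∃[ xs ] IsPartition m xs × insertFixed 1 xs ≡ ys × fixedPart 1 xs ≡ d
insertFixed-surjective {m} {d} {ys} (isPartition pos dec total) (i , refl , value) =
  xs , isPartition (All.tail (All-resp-↭ perm pos)) (removeAt-decreasing i dec) sum-xs , inserted , part
  where
  xs = removeAt ys i
  inserted = proj₁ (insertFixed-removeAt 1 ys i dec value)
  part     = proj₂ (insertFixed-removeAt 1 ys i dec value)

  perm : ys ↭ d ∷ xs
  perm = subst (_↭ d ∷ xs) inserted (subst (λ e → insertFixed 1 xs ↭ e ∷ xs) part (insertFixed-↭ 1 xs))

  sum-xs : sum xs ≡ m
  sum-xs = +-cancelˡ-≡ d (sum xs) m (≡-trans (sym (sum-↭ perm)) (≡-trans total (+-comm m d)))

fixedPartitions : ℕ → ℕ → List (List ℕ)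
fixedPartitions n d = filter (hasFixedPoint? d) (partitions n)

∈-fixedPartitions : ∀ n d {ys} → ys ∈ fixedPartitions n d ⇔ (IsPartition n ys × HasFixedPoint d ys)
∈-fixedPartitions n d {ys} = mk⇔
  (λ q → let r , h = ∈-filter⁻ (hasFixedPoint? d) {xs = partitions n} q
         in Equivalence.to (∈-partitions n ys) r , h)
  (λ (r , h) → ∈-filter⁺ (hasFixedPoint? d) (Equivalence.from (∈-partitions n ys) r) h)

fixedPartitions-unique : ∀ n d → Unique (fixedPartitions n d)
fixedPartitions-unique n d = Unique.filter⁺ (hasFixedPoint? d) (partitions-unique n)

-- The sum of the parts alone separates the two lists, whatever the fixed points are.
fixedPartitions-disjoint : ∀ {n n′} d d′ → n ≢ n′ → Disjoint (fixedPartitions n d) (fixedPartitions n′ d′)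
fixedPartitions-disjoint d d′ n≢n′ (q , r) = n≢n′ (≡-trans (sym (total q)) (total r))
  where
  total : ∀ {n d ys} → ys ∈ fixedPartitions n d → sum ys ≡ n
  total {n} {d} q = IsPartition.total (proj₁ (Equivalence.to (∈-fixedPartitions n d) q))

fixed-point≤ : ∀ {m d ys} → IsPartition (m + d) ys → HasFixedPoint d ys → d ≤ suc m
fixed-point≤ {m} q h with xs , isPartition _ _ refl , _ , refl ← insertFixed-surjective {m} q h =
  fixedPart≤ 1 xs

f-vanishes : ∀ m d → suc m < d → f (m + d) d ≡ 0
f-vanishes m d m<d = cong length (filter-none (hasFixedPoint? d) (All.tabulate
  λ q h → <⇒≱ m<d (fixed-point≤ {m} (Equivalence.to (∈-partitions (m + d) _) q) h)))

module _ (m : ℕ) where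

  row : ℕ → List (List ℕ)
  row i = fixedPartitions (m + suc i) (suc i)

  rows : List (List ℕ)
  rows = concat (applyUpTo row (suc m))

  rows-unique : Unique rows
  rows-unique = Unique.concat⁺
    (All.applyUpTo⁺₂ row (suc m) λ i → fixedPartitions-unique (m + suc i) (suc i))
    (AllPairs.applyUpTo⁺₁ row (suc m) λ {i} {j} i<j _ →
      fixedPartitions-disjoint (suc i) (suc j) (<⇒≢ (+-monoʳ-< m (s≤s i<j))))

  rows-⇔ : ∀ {ys} → ys ∈ rows ⇔ ys ∈ map (insertFixed 1) (partitions m)
  rows-⇔ = mk⇔ to from
    where
    to : ∀ {ys} → ys ∈ rows → ys ∈ map (insertFixed 1) (partitions m)
    to q
      with _ , ys∈row , row∈ ← ∈-concat⁻′ (applyUpTo row (suc m)) q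
      with i , _ , refl ← ∈-applyUpTo⁻ row row∈
      with part , fixed ← Equivalence.to (∈-fixedPartitions (m + suc i) (suc i)) ys∈row
      with xs , part′ , refl , _ ← insertFixed-surjective {m} part fixed =
      ∈-map⁺ (insertFixed 1) (Equivalence.from (∈-partitions m xs) part′)

    from : ∀ {ys} → ys ∈ map (insertFixed 1) (partitions m) → ys ∈ rows
    from q
      with xs , xs∈ , refl ← ∈-map⁻ (insertFixed 1) q
      with part ← Equivalence.to (∈-partitions m xs) xs∈
      with i , index , value ← insertFixed-fixed 1 xs
      with part′ ← subst (λ d → IsPartition (m + d) (insertFixed 1 xs)) (sym index) (insertFixed-isPartition part)
      with fixed ← (i , refl , ≡-trans value (sym index)) =
      ∈-concat⁺′ (Equivalence.from (∈-fixedPartitions (m + suc (toℕ i)) (suc (toℕ i))) (part′ , fixed))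
                 -- The bound `suc (toℕ i) ≤ suc m` is by definition `toℕ i < suc m`, so the row
                 -- lies among those concatenated.
                 (∈-applyUpTo⁺ row (fixed-point≤ {m} part′ fixed))

  f-sum : sum (applyUpTo (λ i → f (m + suc i) (suc i)) (suc m)) ≡ p m
  f-sum = begin
    -- `length (row i)` unfolds to `f (m + suc i) (suc i)`.
    sum (applyUpTo (length ∘ row) (suc m))         ≡⟨ cong sum (map-applyUpTo row length (suc m)) ⟨
    sum (map length (applyUpTo row (suc m)))       ≡⟨ length-concat (applyUpTo row (suc m)) ⟨
    length rows                                    ≡⟨ unique-length rows-unique
                                                        (Unique.map⁺ (insertFixed-injective 1) (partitions-unique m))
                                                        rows-⇔ ⟩
    length (map (insertFixed 1) (partitions m))    ≡⟨ length-map (insertFixed 1) (partitions m) ⟩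
    p m                                            ∎
    where open ≡-Reasoning

theorem1p4 : ∀ (n : ℕ) → 1 ≤ n → SumFrom1 (λ d → f (n + d ∸ 1) d) (p (n ∸ 1))
-- Here `suc m + d ∸ 1` computes to `m + d`, and the cut-off `suc m` is the bound on `d` from
-- `fixed-point≤`.
theorem1p4 (suc m) _ = suc m , f-vanishes m , f-sum m
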